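{- Let $\mathcal{B}$ be a swap structure for $\mathbf{mbC}$. Then there exist a set $I$ and a monomorphism of multialgebras $\hat h:\mathcal{B}\to\prod_{i\in I}\mathcal{B}_{\mathbb{A}_2}^{\mathbf{mbC}}$.
   Context: Let $\Sigma=\{\wedge,\vee,\to,\neg,\circ\}$, with $\wedge,\vee,\to$ binary and $\neg,\circ$ unary. A multialgebra over $\Sigma$ is a nonempty set $B$ with, for each $n$-ary symbol $c$, a function $c^{\mathcal{B}}:B^n\to\wp(B)\setminus\{\emptyset\}$; $|\mathcal{B}|=B$ is its domain. A homomorphism $f:\mathcal{A}\to\mathcal{B}$ is a function between the domains with $f[c^{\mathcal{A}}(\vec a)]\subseteq c^{\mathcal{B}}(f(\vec a))$ for all $c$ and $\vec a$. These form the category $\mathbf{MAlg}(\Sigma)$; a monomorphism of multialgebras is a monomorphism in this category. The product $\prod_{i\in I}\mathcal{A}_i$ has as domain the cartesian product of the domains and multioperations $c(\vec a)=\prod_{i\in I}c^{\mathcal{A}_i}(\pi_i(\vec a))$ (for $I=\emptyset$ it is the one-element multialgebra). For a Boolean algebra $\mathcal{A}$ with domain $A$ (the one-element Boolean algebra is allowed) and $z\in A^3$ write $z=(z_1,z_2,z_3)$. Put $\mathrm{B}_{\mathcal{A}}^{\mathbf{mbC}}=\{z\in A^3 : z_1\vee z_2=1 \text{ and } z_1\wedge z_2\wedge z_3=0\}$. A swap structure for $\mathbf{mbC}$ over $\mathcal{A}$ is a multialgebra $\mathcal{B}$ over $\Sigma$ with domain $B\subseteq \mathrm{B}_{\mathcal{A}}^{\mathbf{mbC}}$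 such that $0\in\{z_1: z\in B\}$ and for all $z,w\in B$: (i) $\emptyset\ne z\#w\subseteq\{u\in B: u_1=z_1\# w_1\}$ for $\#\in\{\wedge,\vee,\to\}$; (ii) $\emptyset\neq\neg z\subseteq\{u\in B:u_1=z_2\}$; (iii) $\emptyset\ne\circ z\subseteq\{u\in B:u_1=z_3\}$. A swap structure for $\mathbf{mbC}$ is one over some Boolean algebra. The full swap structure $\mathcal{B}_{\mathcal{A}}^{\mathbf{mbC}}$ has domain $\mathrm{B}_{\mathcal{A}}^{\mathbf{mbC}}$ and equality in the right-hand inclusions of (i)–(iii). $\mathbb{A}_2$ is the two-element Boolean algebra. -}

module Defs where

open import Algebra.Lattice.Bundles using (BooleanAlgebra)
import Algebra.Lattice.Properties.BooleanAlgebra as BooleanAlgebraProperties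
open import Data.Bool.Properties using (∨-∧-booleanAlgebra)
open import Data.Nat using (ℕ)
open import Data.Product using (Σ; Σ-syntax; ∃-syntax; _×_; _,_; proj₁; proj₂)
open import Data.Product.Relation.Binary.Pointwise.NonDependent using (×-setoid)
open import Data.Vec using (Vec; []; _∷_; map)
open import Data.Vec.Properties using (map-∘)
open import Data.Vec.Relation.Binary.Pointwise.Inductive using (Pointwise; []; _∷_; map⁺)
open import Function using (id)
open import Function.Bundles using (Func)
open import Function.Construct.Composition as Composition using ()
open import Level using (Level; suc; _⊔_; 0ℓ)
open import Relation.Binary.Bundles using (Setoid)
open import Relation.Binary.Construct.On as On using ()
open import Relation.Binary.Definitions using (_Respects_)
open import Relation.Binary.PropositionalEquality using (subst; sym)
open import Relation.Unary using (Pred; _∈_)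

private
  variable
    a b c i ℓ : Level
    n : ℕ

data Symbol : ℕ → Set where
  conj disj impl : Symbol 2
  neg circ       : Symbol 1

-- Sets are setoids, so subsets are predicates that respect the equality, and
-- functions into a power set respect it in their arguments as well.

record MultiOperations (S : Setoid ℓ ℓ) : Set (suc ℓ) where
  open Setoid S using (Carrier; _≈_)
  field
    op          : Symbol n → Vec Carrier n → Pred Carrier ℓ
    op-nonempty : (s : Symbol n) (xs : Vec Carrier n) → ∃[ u ] u ∈ op s xs
    op-resp     : (s : Symbol n) {xs ys : Vec Carrier n} {u v : Carrier} →
                  Pointwise _≈_ xs ys → u ≈ v → u ∈ op s xs → v ∈ op s ys

record Multialgebra (ℓ : Level) : Set (suc ℓ) where
  field
    setoid     : Setoid ℓ ℓ
    nonempty   : Setoid.Carrier setoid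
    operations : MultiOperations setoid
  open Setoid setoid public
  open MultiOperations operations public

record Hom (𝒜 : Multialgebra a) (ℬ : Multialgebra b) : Set (a ⊔ b) where
  private
    module A = Multialgebra 𝒜
    module B = Multialgebra ℬ
  field
    func : Func A.setoid B.setoid
  open Func func public using (to; cong)
  field
    homo : (s : Symbol n) (xs : Vec A.Carrier n) {u : A.Carrier} →
           u ∈ A.op s xs → to u ∈ B.op s (map to xs)

infixr 9 _∘ₕ_
_∘ₕ_ : {𝒜 : Multialgebra a} {ℬ : Multialgebra b} {𝒞 : Multialgebra c} →
       Hom ℬ 𝒞 → Hom 𝒜 ℬ → Hom 𝒜 𝒞
_∘ₕ_ {𝒞 = 𝒞} g f = record
  { func = Composition.function (Hom.func f) (Hom.func g)
  ; homo = λ s xs {u} u∈ →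
      subst (λ ys → Hom.to g (Hom.to f u) ∈ Multialgebra.op 𝒞 s ys)
            (sym (map-∘ (Hom.to g) (Hom.to f) xs))
            (Hom.homo g s (map (Hom.to f) xs) (Hom.homo f s xs u∈))
  }

infix 4 _≈ₕ_
_≈ₕ_ : {𝒜 : Multialgebra a} {ℬ : Multialgebra b} → Hom 𝒜 ℬ → Hom 𝒜 ℬ → Set (a ⊔ b)
_≈ₕ_ {ℬ = ℬ} f g = ∀ x → Multialgebra._≈_ ℬ (Hom.to f x) (Hom.to g x)

Mono : {𝒜 ℬ : Multialgebra ℓ} → Hom 𝒜 ℬ → Set (suc ℓ)
Mono {ℓ = ℓ} {𝒜 = 𝒜} h =
  (𝒞 : Multialgebra ℓ) (f g : Hom 𝒞 𝒜) → h ∘ₕ f ≈ₕ h ∘ₕ g → f ≈ₕ g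

∏ : (I : Set i) → (I → Multialgebra a) → Multialgebra (i ⊔ a)
∏ I 𝒜 = record
  { setoid = record
    { Carrier = ∀ j → A.Carrier j
    ; _≈_ = λ x y → ∀ j → A._≈_ j (x j) (y j)
    ; isEquivalence = record
      { refl  = λ j → A.refl j
      ; sym   = λ p j → A.sym j (p j)
      ; trans = λ p q j → A.trans j (p j) (q j)
      }
    }
  ; nonempty = λ j → A.nonempty j
  ; operations = record
    { op          = λ s xs u → ∀ j → u j ∈ A.op j s (map (λ x → x j) xs)
    ; op-nonempty = λ s xs →
        (λ j → proj₁ (A.op-nonempty j s (map (λ x → x j) xs))) ,
        (λ j → proj₂ (A.op-nonempty j s (map (λ x → x j) xs)))
    ; op-resp     = λ s xs≈ys u≈v u∈ j →
        A.op-resp j s (map⁺ (λ x≈y → x≈y j) xs≈ys) (u≈v j) (u∈ j)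
    }
  }
  where module A j = Multialgebra (𝒜 j)

module Swap {ℓ} (𝒜 : BooleanAlgebra ℓ ℓ) where
  open BooleanAlgebra 𝒜 renaming (setoid to A-setoid; refl to ≈-refl; sym to ≈-sym; trans to ≈-trans)
  open BooleanAlgebraProperties 𝒜 using (∧-zeroˡ)

  infixr 5 _⇒_
  _⇒_ : Carrier → Carrier → Carrier
  x ⇒ y = ¬ x ∨ y

  Triple-setoid : Setoid ℓ ℓ
  Triple-setoid = ×-setoid A-setoid (×-setoid A-setoid A-setoid)

  open Setoid Triple-setoid public using () renaming (Carrier to Triple; _≈_ to _≈₃_)

  π₁ π₂ π₃ : Triple → Carrier
  π₁ (z₁ , _ , _) = z₁
  π₂ (_ , z₂ , _) = z₂
  π₃ (_ , _ , z₃) = z₃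

  B-mbC : Pred Triple ℓ
  B-mbC z = (π₁ z ∨ π₂ z ≈ ⊤) × (π₁ z ∧ π₂ z ∧ π₃ z ≈ ⊥)

  -- The value that every output of the multioperation has as first coordinate.
  first : Symbol n → Vec Triple n → Carrier
  first conj (z ∷ w ∷ []) = π₁ z ∧ π₁ w
  first disj (z ∷ w ∷ []) = π₁ z ∨ π₁ w
  first impl (z ∷ w ∷ []) = π₁ z ⇒ π₁ w
  first neg  (z ∷ [])     = π₂ z
  first circ (z ∷ [])     = π₃ z

  subsetoid : Pred Triple ℓ → Setoid ℓ ℓ
  subsetoid P = On.setoid {B = Σ Triple P} Triple-setoid proj₁

  record SwapStructure : Set (suc ℓ) where
    field
      Domain      : Pred Triple ℓ
      Domain-resp : Domain Respects _≈₃_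
      Domain⊆     : ∀ {z} → z ∈ Domain → z ∈ B-mbC
      has-⊥       : ∃[ z ] (z ∈ Domain × π₁ z ≈ ⊥)
      operations  : MultiOperations (subsetoid Domain)
    open MultiOperations operations public
    field
      op-first    : (s : Symbol n) (zs : Vec (Σ Triple Domain) n) {u : Σ Triple Domain} →
                    u ∈ op s zs → π₁ (proj₁ u) ≈ first s (map proj₁ zs)

    multialgebra : Multialgebra ℓ
    multialgebra = record
      { setoid     = subsetoid Domain
      ; nonempty   = proj₁ has-⊥ , proj₁ (proj₂ has-⊥)
      ; operations = operations
      }

  private
    B-mbC-resp : B-mbC Respects _≈₃_
    B-mbC-resp (e₁ , e₂ , e₃) (p , q) =
      ≈-trans (≈-sym (∨-cong e₁ e₂)) p ,
      ≈-trans (≈-sym (∧-cong e₁ (∧-cong e₂ e₃))) q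

    with-first : (x : Carrier) → Σ[ u ∈ Σ Triple B-mbC ] π₁ (proj₁ u) ≈ x
    with-first x =
      ((x , ¬ x , ⊤) , ∨-complementʳ x ,
        ≈-trans (≈-sym (∧-assoc x (¬ x) ⊤))
          (≈-trans (∧-cong (∧-complementʳ x) ≈-refl) (∧-zeroˡ ⊤))) ,
      ≈-refl

    first-cong : (s : Symbol n) {zs ws : Vec Triple n} →
                 Pointwise _≈₃_ zs ws → first s zs ≈ first s ws
    first-cong conj ((e , _) ∷ (e′ , _) ∷ []) = ∧-cong e e′
    first-cong disj ((e , _) ∷ (e′ , _) ∷ []) = ∨-cong e e′
    first-cong impl ((e , _) ∷ (e′ , _) ∷ []) = ∨-cong (¬-cong e) e′
    first-cong neg  ((_ , e , _) ∷ [])        = e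
    first-cong circ ((_ , _ , e) ∷ [])        = e

  full : SwapStructure
  full = record
    { Domain      = B-mbC
    ; Domain-resp = B-mbC-resp
    ; Domain⊆     = id
    ; has-⊥       = let (z , z∈) , z₁≈⊥ = with-first ⊥ in z , z∈ , z₁≈⊥
    ; operations  = record
      { op          = λ s zs u → π₁ (proj₁ u) ≈ first s (map proj₁ zs)
      ; op-nonempty = λ s zs → with-first (first s (map proj₁ zs))
      ; op-resp     = λ s zs≈ws u≈v p →
          ≈-trans (≈-sym (proj₁ u≈v)) (≈-trans p (first-cong s (map⁺ id zs≈ws)))
      }
    ; op-first    = λ _ _ → id
    }

open Swap public using (SwapStructure; full)
open SwapStructure public using (multialgebra)

𝔸₂ : BooleanAlgebra 0ℓ 0ℓ
𝔸₂ = ∨-∧-booleanAlgebra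

-- The index set consists of the ultrafilters U of 𝒜, seen as maps 𝒜 → 𝔸₂, and
-- ĥ sends z to the family of the triples (U z₁ , U z₂ , U z₃).  It is a
-- homomorphism because the multioperations of the full swap structure over 𝔸₂
-- only constrain first coordinates, and it is injective because every element
-- x ≉ ⊥ lies in an ultrafilter.
--
-- Excluded middle decides every type, not only propositions, hence is a choice
-- operator.  The ultrafilter is obtained by Zermelo's argument for Zorn's lemma:
-- iterate a step that adjoins to a filter some element it leaves undecided, with
-- unions at the limits; the stages form a chain, and the last one is an ultrafilter.
{-# OPTIONS --safe #-}
module Submission where

open import Defs
open import Algebra.Lattice.Bundles using (BooleanAlgebra)
import Algebra.Lattice.Properties.BooleanAlgebra as BooleanAlgebraProperties
open import Axiom.ExcludedMiddle using (ExcludedMiddle)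
open import Axiom.Extensionality.Propositional using (Extensionality)
open import Data.Bool using (Bool; true; false; not; _∧_; _∨_; _≟_)
open import Data.Bool.Properties using (⇔→≡; ¬-not)
open import Data.Product using (Σ-syntax; ∃-syntax; _×_; _,_; proj₁; proj₂)
open import Data.Sum using (_⊎_; inj₁; inj₂; [_,_]′)
open import Data.Vec using (Vec; []; _∷_; map)
open import Function using (_∘_)
open import Function.Bundles using (mk⇔)
open import Level using (Level; 0ℓ)
open import Relation.Binary.PropositionalEquality
  using (_≡_; refl; sym; trans; cong)
open import Relation.Nullary using (¬_; Dec; yes; no; does; contradiction)
open import Relation.Nullary.Decidable using (dec-true; decidable-stable)
import Relation.Binary.Reasoning.Setoid as ≈-Reasoning

private
  variable
    ℓ : Level

-- With truth values in `Bool`, subsets and subsets of subsets stay at level `ℓ`; `em` at that level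
-- then decides membership in unions, and the ultrafilters form a type in `Set ℓ`.
Subset : Set ℓ → Set ℓ
Subset X = X → Bool

module _ {X : Set ℓ} where

  infix 4 _∈_ _∉_ _⊆_

  _∈_ _∉_ : X → Subset X → Set
  x ∈ F = F x ≡ true
  x ∉ F = ¬ x ∈ F

  _⊆_ : Subset X → Subset X → Set ℓ
  F ⊆ G = ∀ {x} → x ∈ F → x ∈ G

  ⊆-antisym : Extensionality ℓ 0ℓ → {F G : Subset X} → F ⊆ G → G ⊆ F → F ≡ G
  ⊆-antisym ext F⊆G G⊆F = ext λ x → ⇔→≡ (mk⇔ F⊆G G⊆F)

does-true : {A : Set ℓ} (a? : Dec A) → does a? ≡ true → A
does-true (yes a) _ = a

-- Zermelo's tower over an inflationary step

module Tower {ℓ} (em : ExcludedMiddle ℓ) (ext : Extensionality ℓ 0ℓ) {X : Set ℓ}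
  (base : Subset X) (next : Subset X → Subset X) (inflationary : ∀ F → F ⊆ next F) where

  ⋃ : Subset (Subset X) → Subset X
  ⋃ C x = does (em {∃[ F ] (F ∈ C × x ∈ F)})

  ∈⋃⁺ : ∀ C {F} → F ∈ C → F ⊆ ⋃ C
  ∈⋃⁺ C F∈C x∈F = dec-true em (_ , F∈C , x∈F)

  ∈⋃⁻ : ∀ C {x} → x ∈ ⋃ C → ∃[ F ] (F ∈ C × x ∈ F)
  ∈⋃⁻ C = does-true em

  -- Unions are allowed over arbitrary nonempty families of stages; that these are chains follows
  -- from `total`. Nonemptiness keeps `base` inside each union.
  data Stage : Subset X → Set ℓ where
    start : Stage base
    step  : ∀ {F} → Stage F → Stage (next F)
    limit : (C : Subset (Subset X)) → ∃[ F ] F ∈ C → (∀ {F} → F ∈ C → Stage F) → Stage (⋃ C)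

  base⊆ : ∀ {F} → Stage F → base ⊆ F
  base⊆ start                 x∈ = x∈
  base⊆ (step {F} s)          x∈ = inflationary F (base⊆ s x∈)
  base⊆ (limit C (F , F∈C) s) x∈ = ∈⋃⁺ C F∈C (base⊆ (s F∈C) x∈)

  ⊆⊎∃∉ : (F G : Subset X) → F ⊆ G ⊎ ∃[ x ] (x ∈ F × x ∉ G)
  ⊆⊎∃∉ F G with em {∃[ x ] (x ∈ F × x ∉ G)}
  ... | yes p = inj₂ p
  ... | no ¬p = inj₁ λ {x} x∈F → decidable-stable (_ ≟ _) λ x∉G → ¬p (x , x∈F , x∉G)

  -- These are the extreme points in the proof of the Bourbaki-Witt theorem: no step from a stage
  -- strictly below `G` jumps past `G`.
  Gapless : Subset X → Set ℓ
  Gapless G = ∀ {F} → Stage F → F ⊆ G → F ≡ G ⊎ next F ⊆ G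

  -- Induction on `F`. If a union is not inside `G`, then some member is not inside `G` either, and
  -- by induction that member contains `next G`.
  compare-gapless : ∀ {F G} → Stage F → Stage G → Gapless G → F ⊆ G ⊎ next G ⊆ F
  compare-gapless start        t gap = inj₁ (base⊆ t)
  compare-gapless (step {F} s) t gap with compare-gapless s t gap
  ... | inj₂ G⁺⊆F = inj₂ (inflationary F ∘ G⁺⊆F)
  ... | inj₁ F⊆G with gap s F⊆G
  ...   | inj₁ refl = inj₂ λ x∈ → x∈
  ...   | inj₂ F⁺⊆G = inj₁ F⁺⊆G
  compare-gapless {G = G} (limit C _ s) t gap with ⊆⊎∃∉ (⋃ C) G
  ... | inj₁ ⋃⊆G = inj₁ ⋃⊆G
  ... | inj₂ (x , x∈⋃ , x∉G) with ∈⋃⁻ C x∈⋃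
  ...   | F , F∈C , x∈F with compare-gapless (s F∈C) t gap
  ...     | inj₁ F⊆G  = contradiction (F⊆G x∈F) x∉G
  ...     | inj₂ G⁺⊆F = inj₂ (∈⋃⁺ C F∈C ∘ G⁺⊆F)

  -- Induction on `G`, comparing `F` with the predecessor of `G`, or with a member of the union that
  -- has an element outside `F`; both are gapless by induction.
  gapless : ∀ {G} → Stage G → Gapless G
  gapless start s F⊆base = inj₁ (⊆-antisym ext F⊆base (base⊆ s))
  gapless (step {G} t) s F⊆G⁺ with compare-gapless s t (gapless t)
  ... | inj₂ G⁺⊆F = inj₁ (⊆-antisym ext F⊆G⁺ G⁺⊆F)
  ... | inj₁ F⊆G with gapless t s F⊆G
  ...   | inj₁ refl = inj₂ λ x∈ → x∈
  ...   | inj₂ F⁺⊆G = inj₂ (inflationary G ∘ F⁺⊆G)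
  gapless (limit C _ t) {F} s F⊆⋃ with ⊆⊎∃∉ (⋃ C) F
  ... | inj₁ ⋃⊆F = inj₁ (⊆-antisym ext F⊆⋃ ⋃⊆F)
  ... | inj₂ (x , x∈⋃ , x∉F) with ∈⋃⁻ C x∈⋃
  ...   | G , G∈C , x∈G with compare-gapless s (t G∈C) (gapless (t G∈C))
  ...     | inj₂ G⁺⊆F = contradiction (G⁺⊆F (inflationary G x∈G)) x∉F
  ...     | inj₁ F⊆G with gapless (t G∈C) s F⊆G
  ...       | inj₁ refl = contradiction x∈G x∉F
  ...       | inj₂ F⁺⊆G = inj₂ (∈⋃⁺ C G∈C ∘ F⁺⊆G)

  total : ∀ {F G} → Stage F → Stage G → F ⊆ G ⊎ G ⊆ F
  total {G = G} s t with compare-gapless s t (gapless t)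
  ... | inj₁ F⊆G  = inj₁ F⊆G
  ... | inj₂ G⁺⊆F = inj₂ (G⁺⊆F ∘ inflationary G)

  stages : Subset (Subset X)
  stages F = does (em {Stage F})

  last : Subset X
  last = ⋃ stages

  last-stage : Stage last
  last-stage = limit stages (base , dec-true em start) (does-true em)

  -- The family united in `last` contains every stage, `next last` among them.
  last-fixed : next last ⊆ last
  last-fixed = ∈⋃⁺ stages (dec-true em (step last-stage))

-- Filters and ultrafilters of a Boolean algebra

module Ultrafilters {ℓ} (𝒜 : BooleanAlgebra ℓ ℓ) where
  private
    module A = BooleanAlgebra 𝒜
  open A using (Carrier; _≈_)
  open BooleanAlgebraProperties 𝒜
    using (∨-identityʳ; ∨-zeroʳ; ∧-identityʳ; ∨-idem)
  open ≈-Reasoning A.setoid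

  record ProperFilter (F : Subset Carrier) : Set ℓ where
    field
      resp : ∀ {x y} → x ≈ y → x ∈ F → y ∈ F
      ⊤∈   : A.⊤ ∈ F
      ∧⁺   : ∀ {x y} → x ∈ F → y ∈ F → x A.∧ y ∈ F
      ∨⁺ˡ  : ∀ {x y} → x ∈ F → x A.∨ y ∈ F
      ⊥∉   : A.⊥ ∉ F

    ∨⁺ʳ : ∀ {x y} → y ∈ F → x A.∨ y ∈ F
    ∨⁺ʳ y∈F = resp (A.∨-comm _ _) (∨⁺ˡ y∈F)

    ∧⁻ˡ : ∀ {x y} → x A.∧ y ∈ F → x ∈ F
    ∧⁻ˡ {x} {y} xy∈F = resp (A.trans (A.∨-comm _ _) (A.∨-absorbs-∧ x y)) (∨⁺ˡ xy∈F)

    ∧⁻ʳ : ∀ {x y} → x A.∧ y ∈ F → y ∈ F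
    ∧⁻ʳ xy∈F = ∧⁻ˡ (resp (A.∧-comm _ _) xy∈F)

    ¬⁻ : ∀ {x} → A.¬ x ∈ F → x ∉ F
    ¬⁻ ¬x∈F x∈F = ⊥∉ (resp (A.∧-complementʳ _) (∧⁺ x∈F ¬x∈F))

  record Ultrafilter : Set ℓ where
    field
      carrier : Subset Carrier
      proper  : ProperFilter carrier
      decides : ∀ {x} → x ∉ carrier → A.¬ x ∈ carrier
    open ProperFilter proper public

    -- The `value` lemmas make `carrier` a homomorphism of Boolean algebras into `𝔸₂`.
    value-cong : ∀ {x y} → x ≈ y → carrier x ≡ carrier y
    value-cong x≈y = ⇔→≡ (mk⇔ (resp x≈y) (resp (A.sym x≈y)))

    value-¬ : ∀ x → carrier (A.¬ x) ≡ not (carrier x)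
    value-¬ x with carrier x in eq
    ... | true  = ¬-not λ ¬x∈ → ¬⁻ ¬x∈ eq
    ... | false = decides λ x∈ → contradiction (trans (sym eq) x∈) λ ()

    value-∧ : ∀ x y → carrier (x A.∧ y) ≡ carrier x ∧ carrier y
    value-∧ x y with carrier x in eq | carrier y in eq′
    ... | true  | true  = ∧⁺ eq eq′
    ... | true  | false = ¬-not λ xy∈ → contradiction (trans (sym eq′) (∧⁻ʳ xy∈)) λ ()
    ... | false | _     = ¬-not λ xy∈ → contradiction (trans (sym eq) (∧⁻ˡ xy∈)) λ ()

    -- Primeness: `decides` puts the complement of `x` into the filter, and its meet with the join
    -- lies below `y`.
    ∨⁻ : ∀ {x y} → x A.∨ y ∈ carrier → x ∉ carrier → y ∈ carrier
    ∨⁻ {x} {y} x∨y∈ x∉ = ∧⁻ʳ (resp eq (∧⁺ (decides x∉) x∨y∈))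
      where
      eq : A.¬ x A.∧ (x A.∨ y) ≈ A.¬ x A.∧ y
      eq = begin
        A.¬ x A.∧ (x A.∨ y)                ≈⟨ A.∧-distribˡ-∨ _ _ _ ⟩
        (A.¬ x A.∧ x) A.∨ (A.¬ x A.∧ y)    ≈⟨ A.∨-congʳ (A.∧-complementˡ x) ⟩
        A.⊥ A.∨ (A.¬ x A.∧ y)              ≈⟨ A.∨-comm _ _ ⟩
        (A.¬ x A.∧ y) A.∨ A.⊥              ≈⟨ ∨-identityʳ _ ⟩
        A.¬ x A.∧ y                        ∎

    value-∨ : ∀ x y → carrier (x A.∨ y) ≡ carrier x ∨ carrier y
    value-∨ x y with carrier x in eq | carrier y in eq′
    ... | true  | _     = ∨⁺ˡ eq
    ... | false | true  = ∨⁺ʳ eq′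
    ... | false | false = ¬-not λ x∨y∈ →
      contradiction (trans (sym eq′) (∨⁻ x∨y∈ λ x∈ → contradiction (trans (sym eq) x∈) λ ())) λ ()

    value-⊥ : carrier A.⊥ ≡ false
    value-⊥ = ¬-not ⊥∉

  open ProperFilter

  -- If F is a filter, this is the filter generated by F and x.
  adjoin : Carrier → Subset Carrier → Subset Carrier
  adjoin x F y = F (A.¬ x A.∨ y)

  -- The map sending `y` to `A.¬ x A.∨ y` preserves meets and sends bottom to `A.¬ x`, so properness
  -- comes from `A.¬ x ∉ F`.
  adjoin-proper : ∀ {x F} → ProperFilter F → A.¬ x ∉ F → ProperFilter (adjoin x F)
  adjoin-proper p ¬x∉F = record
    { resp = λ y≈z → resp p (A.∨-congˡ y≈z)
    ; ⊤∈   = ∨⁺ʳ p (⊤∈ p)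
    ; ∧⁺   = λ y∈ z∈ → resp p (A.sym (A.∨-distribˡ-∧ _ _ _)) (∧⁺ p y∈ z∈)
    ; ∨⁺ˡ  = λ y∈ → resp p (A.∨-assoc _ _ _) (∨⁺ˡ p y∈)
    ; ⊥∉   = λ ⊥∈ → ¬x∉F (resp p (∨-identityʳ _) ⊥∈)
    }

  -- Existence of ultrafilters

  module _ (em : ExcludedMiddle ℓ) (ext : Extensionality ℓ 0ℓ) where

    principal : Carrier → Subset Carrier
    principal a y = does (em {a A.∨ y ≈ y})

    principal-proper : ∀ {a} → ¬ a ≈ A.⊥ → ProperFilter (principal a)
    principal-proper {a} a≉⊥ = record
      { resp = λ x≈y x∈ → dec-true em
          (A.trans (A.∨-congˡ (A.sym x≈y)) (A.trans (does-true em x∈) x≈y))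
      ; ⊤∈   = dec-true em (∨-zeroʳ a)
      ; ∧⁺   = λ x∈ y∈ → dec-true em
          (A.trans (A.∨-distribˡ-∧ _ _ _) (A.∧-cong (does-true em x∈) (does-true em y∈)))
      ; ∨⁺ˡ  = λ x∈ → dec-true em
          (A.trans (A.sym (A.∨-assoc _ _ _)) (A.∨-congʳ (does-true em x∈)))
      ; ⊥∉   = λ ⊥∈ → a≉⊥ (A.trans (A.sym (∨-identityʳ a)) (does-true em ⊥∈))
      }

    -- The inclusion F ⊆ adjoin x F is automatic when F is a filter; requiring it
    -- makes the step inflationary on all subsets.
    Undecided : Subset Carrier → Set ℓ
    Undecided F = ∃[ x ] (x ∉ F × A.¬ x ∉ F × F ⊆ adjoin x F)

    next : Subset Carrier → Subset Carrier
    next F with em {Undecided F}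
    ... | yes (x , _) = adjoin x F
    ... | no  _       = F

    next-inflationary : ∀ F → F ⊆ next F
    next-inflationary F with em {Undecided F}
    ... | yes (_ , _ , _ , F⊆) = F⊆
    ... | no  _                = λ x∈ → x∈

    next-proper : ∀ {F} → ProperFilter F → ProperFilter (next F)
    next-proper {F} p with em {Undecided F}
    ... | yes (_ , _ , ¬x∉F , _) = adjoin-proper p ¬x∉F
    ... | no  _                  = p

    -- A step at an undecided `y` would add `y` to `F`, since `A.¬ y A.∨ y` is top. So nothing is
    -- undecided, in particular not `x`.
    next-fixed⇒decides : ∀ {F x} → ProperFilter F → next F ⊆ F → x ∉ F → A.¬ x ∈ F
    next-fixed⇒decides {F} {x} p fixed x∉F with em {Undecided F}
    ... | yes (y , y∉F , _) =
      contradiction (fixed (resp p (A.sym (A.∨-complementˡ y)) (⊤∈ p))) y∉F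
    ... | no  ¬undecided    = decidable-stable (_ ≟ _)
      λ ¬x∉F → ¬undecided (x , x∉F , ¬x∉F , ∨⁺ʳ p)

    module _ {a} (a≉⊥ : ¬ a ≈ A.⊥) where
      open Tower em ext (principal a) next next-inflationary

      stage-proper : ∀ {F} → Stage F → ProperFilter F
      stage-proper start    = principal-proper a≉⊥
      stage-proper (step s) = next-proper (stage-proper s)
      stage-proper (limit C (F₀ , F₀∈C) s) = record
        { resp = λ x≈y x∈ → let F , F∈C , x∈F = ∈⋃⁻ C x∈ in
            ∈⋃⁺ C F∈C (resp (stage-proper (s F∈C)) x≈y x∈F)
        ; ⊤∈   = ∈⋃⁺ C F₀∈C (⊤∈ (stage-proper (s F₀∈C)))
        -- The two elements may come from different members; by `total` the larger member contains
        -- both.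
        ; ∧⁺   = λ x∈ y∈ →
            let F , F∈C , x∈F = ∈⋃⁻ C x∈
                G , G∈C , y∈G = ∈⋃⁻ C y∈
            in [ (λ F⊆G → ∈⋃⁺ C G∈C (∧⁺ (stage-proper (s G∈C)) (F⊆G x∈F) y∈G))
               , (λ G⊆F → ∈⋃⁺ C F∈C (∧⁺ (stage-proper (s F∈C)) x∈F (G⊆F y∈G)))
               ]′ (total (s F∈C) (s G∈C))
        ; ∨⁺ˡ  = λ x∈ → let F , F∈C , x∈F = ∈⋃⁻ C x∈ in
            ∈⋃⁺ C F∈C (∨⁺ˡ (stage-proper (s F∈C)) x∈F)
        ; ⊥∉   = λ ⊥∈ → let F , F∈C , ⊥∈F = ∈⋃⁻ C ⊥∈ in
            ⊥∉ (stage-proper (s F∈C)) ⊥∈F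
        }

      ultrafilter-lemma : Σ[ U ∈ Ultrafilter ] a ∈ Ultrafilter.carrier U
      ultrafilter-lemma = record
        { carrier = last
        ; proper  = stage-proper last-stage
        ; decides = next-fixed⇒decides (stage-proper last-stage) last-fixed
        } , base⊆ last-stage (dec-true em (∨-idem a))

    -- Ultrafilters separate elements

    Indistinguishable : Carrier → Carrier → Set ℓ
    Indistinguishable x y = (U : Ultrafilter) → Ultrafilter.carrier U x ≡ Ultrafilter.carrier U y

    -- Were `x A.∧ A.¬ y` not bottom, some ultrafilter would contain it, hence contain `x` but not
    -- `y`.
    indistinguishable⇒≈∧ : ∀ {x y} → Indistinguishable x y → x ≈ x A.∧ y
    indistinguishable⇒≈∧ {x} {y} same = begin
      x                                ≈⟨ ∧-identityʳ x ⟨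
      x A.∧ A.⊤                        ≈⟨ A.∧-congˡ (A.∨-complementʳ y) ⟨
      x A.∧ (y A.∨ A.¬ y)              ≈⟨ A.∧-distribˡ-∨ _ _ _ ⟩
      (x A.∧ y) A.∨ (x A.∧ A.¬ y)      ≈⟨ A.∨-congˡ (decidable-stable em x∧¬y≉⊥⇒⊥) ⟩
      (x A.∧ y) A.∨ A.⊥                ≈⟨ ∨-identityʳ _ ⟩
      x A.∧ y                          ∎
      where
      x∧¬y≉⊥⇒⊥ : ¬ ¬ x A.∧ A.¬ y ≈ A.⊥
      x∧¬y≉⊥⇒⊥ ≉⊥ =
        let U , x∧¬y∈U = ultrafilter-lemma ≉⊥
            module U = Ultrafilter U
        in U.¬⁻ (U.∧⁻ʳ x∧¬y∈U) (trans (sym (same U)) (U.∧⁻ˡ x∧¬y∈U))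

    indistinguishable⇒≈ : ∀ {x y} → Indistinguishable x y → x ≈ y
    indistinguishable⇒≈ {x} {y} same = begin
      x        ≈⟨ indistinguishable⇒≈∧ same ⟩
      x A.∧ y  ≈⟨ A.∧-comm x y ⟩
      y A.∧ x  ≈⟨ indistinguishable⇒≈∧ (sym ∘ same) ⟨
      y        ∎

-- The representation of a swap structure

injective⇒mono : {𝒜 ℬ : Multialgebra ℓ} (h : Hom 𝒜 ℬ) →
  (∀ {x y} → Multialgebra._≈_ ℬ (Hom.to h x) (Hom.to h y) → Multialgebra._≈_ 𝒜 x y) →
  Mono h
injective⇒mono h injective 𝒞 f g hf≈hg x = injective (hf≈hg x)

module _ {𝒜 : BooleanAlgebra ℓ ℓ} (ℬ : SwapStructure 𝒜) where
  open Swap 𝒜 using (first)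
  open Ultrafilters 𝒜
  private
    module B = SwapStructure ℬ
    module 𝟚 = Swap 𝔸₂

  image : Multialgebra.Carrier (multialgebra ℬ) →
    Ultrafilter → Multialgebra.Carrier (multialgebra (full 𝔸₂))
  image ((z₁ , z₂ , z₃) , z∈) U =
    let open Ultrafilter U
        z₁∨z₂≈⊤ , z₁∧z₂∧z₃≈⊥ = B.Domain⊆ z∈
    in
    (carrier z₁ , carrier z₂ , carrier z₃) ,
    -- Both conditions of `B-mbC` are equations, so the homomorphism `carrier` preserves them.
    trans (sym (value-∨ z₁ z₂)) (trans (value-cong z₁∨z₂≈⊤) ⊤∈) ,
    trans (cong (carrier z₁ ∧_) (sym (value-∧ z₂ z₃)))
      (trans (sym (value-∧ z₁ _)) (trans (value-cong z₁∧z₂∧z₃≈⊥) value-⊥))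

  first-image : ∀ {n} (U : Ultrafilter) (s : Symbol n)
    (zs : Vec (Multialgebra.Carrier (multialgebra ℬ)) n) →
    Ultrafilter.carrier U (first s (map proj₁ zs)) ≡
    𝟚.first s (map proj₁ (map (λ x → x U) (map image zs)))
  first-image U conj (z ∷ w ∷ []) = Ultrafilter.value-∧ U _ _
  first-image U disj (z ∷ w ∷ []) = Ultrafilter.value-∨ U _ _
  first-image U impl (z ∷ w ∷ []) =
    trans (Ultrafilter.value-∨ U _ _) (cong (_∨ _) (Ultrafilter.value-¬ U _))
  -- Here `first` picks a coordinate of `z`, to which `image` applies `carrier` directly.
  first-image U neg  (z ∷ [])     = refl
  first-image U circ (z ∷ [])     = refl

  representation : Hom (multialgebra ℬ) (∏ Ultrafilter (λ _ → multialgebra (full 𝔸₂)))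
  representation = record
    { func = record
      { to   = image
      ; cong = λ (e₁ , e₂ , e₃) U → let open Ultrafilter U in
          value-cong e₁ , value-cong e₂ , value-cong e₃
      }
    ; homo = λ s zs u∈ U →
        trans (Ultrafilter.value-cong U (B.op-first s zs u∈)) (first-image U s zs)
    }

theorem7p6 : (∀ {p} → ExcludedMiddle p) →
    (∀ {a b} → Extensionality a b) →
    ∀ {ℓ} (𝒜 : BooleanAlgebra ℓ ℓ) (ℬ : SwapStructure 𝒜) →
    Σ[ I ∈ Set ℓ ] Σ[ ĥ ∈ Hom (multialgebra ℬ) (∏ I (λ _ → multialgebra (full 𝔸₂))) ] Mono ĥ
theorem7p6 em ext 𝒜 ℬ =
  Ultrafilter , representation ℬ , injective⇒mono (representation ℬ) λ {x} {y} same →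
    indistinguishable⇒≈ em ext (λ U → proj₁ (same U)) ,
    indistinguishable⇒≈ em ext (λ U → proj₁ (proj₂ (same U))) ,
    indistinguishable⇒≈ em ext (λ U → proj₂ (proj₂ (same U)))
  where open Ultrafilters 𝒜
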